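{- The sequence $\{U_{2n}\}_{n=1}^\infty$ is a Newton-Euler sequence, and the sequence $\{(-1)^nU_{2n}\}_{n=1}^\infty$ is realizable.
   Context: $[x]$ is the greatest integer not exceeding $x$. The sequence $\{U_n\}_{n\ge0}$ is defined by $U_0=1$ and $U_n=-2\sum_{k=1}^{[n/2]}\binom n{2k}U_{n-2k}$ for $n\ge1$. If $\{a_n\}_{n=1}^\infty$ and $\{b_n\}_{n=1}^\infty$ are two sequences satisfying $a_1=b_1$ and $b_n+a_1b_{n-1}+\cdots+a_{n-1}b_1=na_n$ for $n>1$, then $(a_n,b_n)$ is called a Newton-Euler pair; if moreover $a_n\in\mathbb Z$ for all $n=1,2,3,\ldots$, then $\{b_n\}$ is called a Newton-Euler sequence. A sequence $\{b_n\}_{n=1}^\infty$ of nonnegative integers is called realizable if there is a set $X$ and a map $T:X\to X$ such that, for every $n\ge1$, $b_n$ is the number of fixed points of $T^n$. -}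

module Defs where

open import Data.Fin using (Fin; toℕ)
open import Data.Integer using (ℤ; +_; -_; _+_; _*_; 1ℤ)
open import Data.Integer.Properties using (+-0-monoid)
open import Data.Nat as ℕ using (ℕ; zero; suc; _∸_; _/_; _<_; _≥_; _>_; s≤s)
open import Data.Nat.Combinatorics using (_C_)
open import Data.Nat.Induction using (<-rec; <-Rec; <-wellFounded)
open import Data.Nat.Properties using (m∸n≤m)
open import Data.Product using (Σ-syntax; ∃-syntax; _×_)
open import Function using (_↔_)
import Function.Endo.Propositional as Endo
open import Induction.WellFounded using (module FixPoint)
open import Relation.Binary.PropositionalEquality using (_≡_; refl; cong)

open import Algebra.Properties.Monoid.Sum +-0-monoid
  using (sum-syntax; sum-cong-≗)

private
  decrease : ∀ m k → suc m ∸ 2 ℕ.* suc k < suc m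
  decrease m k = s≤s (m∸n≤m m (k ℕ.+ 1 ℕ.* suc k))

-- The summation index k ≥ 1 is written k = suc (toℕ i).
U-step : ∀ n → <-Rec (λ _ → ℤ) n → ℤ
U-step zero      _ = 1ℤ
U-step n@(suc m) u = - (+ 2) *
  (∑[ i < n / 2 ] (+ (n C (2 ℕ.* suc (toℕ i))) * u (decrease m (toℕ i))))

U : ℕ → ℤ
U = <-rec (λ _ → ℤ) U-step

private
  U-step-ext : ∀ n {u v : <-Rec (λ _ → ℤ) n} →
               (∀ {m} (m<n : m < n) → u m<n ≡ v m<n) → U-step n u ≡ U-step n v
  U-step-ext zero    _   = refl
  U-step-ext (suc m) u≗v = cong (- (+ 2) *_)
    (sum-cong-≗ {suc m / 2}
      (λ i → cong (+ (suc m C (2 ℕ.* suc (toℕ i))) *_) (u≗v (decrease m (toℕ i)))))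

U-zero : U 0 ≡ 1ℤ
U-zero = refl

U-rec : ∀ n → n ≥ 1 →
        U n ≡ - (+ 2) * (∑[ i < n / 2 ] (+ (n C (2 ℕ.* suc (toℕ i))) * U (n ∸ 2 ℕ.* suc (toℕ i))))
U-rec (suc m) _ = FixPoint.unfold-wfRec <-wellFounded (λ _ → ℤ) U-step U-step-ext {suc m}

-- Sequences indexed by n ≥ 1 are functions on ℕ; the definitions below never
-- use their value at 0.

-- A Newton-Euler sequence requires a to be integral, which forces b to be
-- integral as well, so pairs are taken over ℤ.
NewtonEulerPair : (a b : ℕ → ℤ) → Set
NewtonEulerPair a b =
  (a 1 ≡ b 1) ×
  (∀ n → n > 1 →
    b n + (∑[ i < n ∸ 1 ] (a (suc (toℕ i)) * b (n ∸ suc (toℕ i)))) ≡ + n * a n)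

NewtonEulerSequence : (ℕ → ℤ) → Set
NewtonEulerSequence b = ∃[ a ] NewtonEulerPair a b

FixedPoint : {X : Set} → (X → X) → Set
FixedPoint {X} f = Σ[ x ∈ X ] f x ≡ x

infixr 8 _^^_

_^^_ : {X : Set} → (X → X) → ℕ → (X → X)
_^^_ {X} = Endo._^_ X

-- The equation b n ≡ + m makes nonnegativity of the terms part of realizability.
Realizable : (ℕ → ℤ) → Set₁
Realizable b =
  Σ[ X ∈ Set ] Σ[ T ∈ (X → X) ]
    (∀ n → n ≥ 1 → ∃[ m ] (b n ≡ + m) × (Fin m ↔ FixedPoint (T ^^ n)))

{-# OPTIONS --safe #-}

-- Let b n = U 2n, up to the sign (-1)ⁿ. Newton-Euler means that exp (∑ b n xⁿ / n) has integer coefficients;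
-- this holds for b n = ± qⁿ (the series (1 - q x)^∓¹), and is stable under sums. The recurrence says that
-- U n = φ (xⁿ), where the functional φ sends f (x + 1) + f (x - 1) - f (x) = (1 + δ²) f to f 0. Hence
-- φ f = ∑ₖ (-1)ᵏ (δ²ᵏ f)(0), which on polynomials of bounded degree is an integer combination of values of f,
-- so on every initial segment b is an integer combination of sequences qⁿ.
--
-- For realizability, peel factors (1 - xᵐ)⁻¹ off the exponential: if b vanishes below m, then m divides b m, and
-- subtracting b m / m cycles of length m makes b vanish at m as well. The number of cycles is never negative,
-- because (-1)ⁿ U 2n grows fast enough to dominate the sum of all its predecessors; the growth rate
-- C(2n, 2) is read off the recurrence, an alternating sum whose terms decrease by a factor at least 2.

module Submission where

open import Defs
open import Data.Integer using (_*_; _^_; -1ℤ)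
open import Data.Nat as ℕ using (ℕ)
open import Data.Product using (_×_)

open import Axiom.UniquenessOfIdentityProofs using (module Decidable⇒UIP)
open import Data.Bool using (if_then_else_)
open import Data.Empty using (⊥-elim)
open import Data.Fin as Fin using (Fin; toℕ)
open import Data.Fin.Properties as Fin using (toℕ-injective; toℕ<n; toℕ-fromℕ<; +↔⊎; *↔×)
open import Data.Integer using (ℤ; +_; -_; _+_; _-_; 0ℤ; 1ℤ; ∣_∣)
import Data.Integer.Properties as ℤ
open import Data.Integer.Tactic.RingSolver using (solve-∀)
open import Data.List using (applyUpTo; _∷_; [])
open import Data.List.Properties using (applyUpTo-∷ʳ)
open import Data.Nat using (zero; suc; _≤_; _<_; _∸_; z≤n; s≤s; _%_; _/_)
open import Data.Nat.Combinatorics using (_C_; nC1≡n; nCk+nC[k+1]≡[n+1]C[k+1])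
open import Data.Nat.Divisibility using (_∣_; _∣?_; divides; ∣-refl; ∣⇒≤; ∣m∣n⇒∣m+n; ∣m+n∣m⇒∣n)
open import Data.Nat.DivMod
  using (_mod_; m≡m%n+[m/n]*n; m<n⇒m%n≡m; %-distribˡ-+; m%n%n≡m%n; [m+kn]%n≡m%n; m*n/n≡m)
open import Data.Nat.ListAction using (sum)
open import Data.Nat.ListAction.Properties using (sum-++)
import Data.Nat.Properties as ℕ
import Data.Nat.Tactic.RingSolver as ℕ-Solver
open import Data.Product using (Σ; Σ-syntax; ∃-syntax; _,_; proj₁; proj₂)
open import Data.Product.Properties using (≡-dec)
open import Data.Sum using (_⊎_; inj₁; inj₂)
open import Data.Sum.Function.Propositional using (_⊎-↔_)
open import Function using (_∘_; _↔_; mk↔ₛ′)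
open import Function.Properties.Inverse using (↔-trans; ↔-sym)
open import Function.Related.TypeIsomorphisms using (Σ-assoc)
open import Relation.Binary using (DecidableEquality; tri<; tri≈; tri>)
open import Relation.Binary.PropositionalEquality
open import Relation.Nullary using (Dec; does; yes; no; ¬_)
open import Relation.Nullary.Decidable using (dec-true; dec-false)

open import Algebra.Properties.CommutativeMonoid.Sum ℤ.+-0-commutativeMonoid using (∑-distrib-+)
import Algebra.Properties.CommutativeSemiring.Binomial ℤ.+-*-commutativeSemiring as Binomial
open import Algebra.Properties.Monoid.Sum ℤ.+-0-monoid using (sum-syntax; sum-cong-≗)
import Algebra.Properties.Semiring.Exp ℤ.+-*-semiring as Exp
import Algebra.Properties.Semiring.Mult ℤ.+-*-semiring as Mult
open import Algebra.Properties.Semiring.Sum ℤ.+-*-semiring using (*-distribˡ-sum)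

-- Formal power series and their exponentials

infixl 7 _⊛_

_⊛_ : (ℕ → ℤ) → (ℕ → ℤ) → ℕ → ℤ
(f ⊛ g) zero    = f 0 * g 0
(f ⊛ g) (suc n) = f 0 * g (suc n) + ((f ∘ suc) ⊛ g) n

∂ : (ℕ → ℤ) → ℕ → ℤ
∂ f n = + suc n * f (suc n)

⊛-cong-≤ : ∀ {f f′ g g′} n → (∀ i → i ≤ n → f i ≡ f′ i) → (∀ i → i ≤ n → g i ≡ g′ i) →
           (f ⊛ g) n ≡ (f′ ⊛ g′) n
⊛-cong-≤ zero    f≡ g≡ = cong₂ _*_ (f≡ 0 z≤n) (g≡ 0 z≤n)
⊛-cong-≤ (suc n) f≡ g≡ = cong₂ _+_
  (cong₂ _*_ (f≡ 0 z≤n) (g≡ (suc n) ℕ.≤-refl))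
  (⊛-cong-≤ n (λ i i≤n → f≡ (suc i) (s≤s i≤n)) (λ i i≤n → g≡ i (ℕ.m≤n⇒m≤1+n i≤n)))

⊛-congˡ : ∀ f {g g′} → g ≗ g′ → f ⊛ g ≗ f ⊛ g′
⊛-congˡ f g≗ n = ⊛-cong-≤ {f} n (λ _ _ → refl) (λ i _ → g≗ i)

⊛-congʳ : ∀ {f f′} g → f ≗ f′ → f ⊛ g ≗ f′ ⊛ g
⊛-congʳ g f≗ n = ⊛-cong-≤ {g = g} n (λ i _ → f≗ i) (λ _ _ → refl)

-- Scaling and addition come together because `(f ⊛ g) ∘ suc` is by definition `f 0` times `g ∘ suc`
-- plus `(f ∘ suc) ⊛ g`.
⊛-linearʳ : ∀ c f g h n → ((λ i → c * f i + g i) ⊛ h) n ≡ c * (f ⊛ h) n + (g ⊛ h) n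
⊛-linearʳ c f g h zero    = lemma c (f 0) (g 0) (h 0)
  where
  lemma : ∀ c x y z → (c * x + y) * z ≡ c * (x * z) + y * z
  lemma = solve-∀
⊛-linearʳ c f g h (suc n) = trans
  (cong (_+_ ((c * f 0 + g 0) * h (suc n))) (⊛-linearʳ c (f ∘ suc) (g ∘ suc) h n))
  (lemma c (f 0) (g 0) (h (suc n)) (((f ∘ suc) ⊛ h) n) (((g ∘ suc) ⊛ h) n))
  where
  lemma : ∀ c x y z u v → (c * x + y) * z + (c * u + v) ≡ c * (x * z + u) + (y * z + v)
  lemma = solve-∀

⊛-sucʳ : ∀ f g n → (f ⊛ g) (suc n) ≡ f (suc n) * g 0 + (f ⊛ (g ∘ suc)) n
⊛-sucʳ f g zero    = ℤ.+-comm (f 0 * g 1) (f 1 * g 0)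
⊛-sucʳ f g (suc n) = trans
  (cong (_+_ (f 0 * g (suc (suc n)))) (⊛-sucʳ (f ∘ suc) g n))
  (lemma (f 0 * g (suc (suc n))) (f (suc (suc n)) * g 0) (((f ∘ suc) ⊛ (g ∘ suc)) n))
  where
  lemma : ∀ x y z → x + (y + z) ≡ y + (x + z)
  lemma = solve-∀

⊛-comm : ∀ f g → f ⊛ g ≗ g ⊛ f
⊛-comm f g zero    = ℤ.*-comm (f 0) (g 0)
⊛-comm f g (suc n) = trans
  (cong₂ _+_ (ℤ.*-comm (f 0) (g (suc n))) (⊛-comm (f ∘ suc) g n))
  (sym (⊛-sucʳ g f n))

⊛-linearˡ : ∀ c f g h n → (h ⊛ (λ i → c * f i + g i)) n ≡ c * (h ⊛ f) n + (h ⊛ g) n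
⊛-linearˡ c f g h n = begin
  (h ⊛ (λ i → c * f i + g i)) n  ≡⟨ ⊛-comm h (λ i → c * f i + g i) n ⟩
  ((λ i → c * f i + g i) ⊛ h) n  ≡⟨ ⊛-linearʳ c f g h n ⟩
  c * (f ⊛ h) n + (g ⊛ h) n      ≡⟨ cong₂ (λ x y → c * x + y) (⊛-comm f h n) (⊛-comm g h n) ⟩
  c * (h ⊛ f) n + (h ⊛ g) n      ∎
  where open ≡-Reasoning

-- Next to commutativity this takes the place of associativity, in the form needed to regroup
-- products of exponentials.
⊛-right-comm : ∀ f g h → (f ⊛ g) ⊛ h ≗ (f ⊛ h) ⊛ g
⊛-right-comm f g h zero    = lemma (f 0) (g 0) (h 0)
  where
  lemma : ∀ x y z → x * y * z ≡ x * z * y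
  lemma = solve-∀
⊛-right-comm f g h (suc n) = begin
  f 0 * g 0 * h (suc n) + (((f ⊛ g) ∘ suc) ⊛ h) n
    ≡⟨ cong (_+_ (f 0 * g 0 * h (suc n))) (⊛-linearʳ (f 0) (g ∘ suc) ((f ∘ suc) ⊛ g) h n) ⟩
  f 0 * g 0 * h (suc n) + (f 0 * ((g ∘ suc) ⊛ h) n + (((f ∘ suc) ⊛ g) ⊛ h) n)
    ≡⟨ lemma₁ (f 0) (g 0) (h (suc n)) (((g ∘ suc) ⊛ h) n) ((((f ∘ suc) ⊛ g) ⊛ h) n) ⟩
  f 0 * (g ⊛ h) (suc n) + (((f ∘ suc) ⊛ g) ⊛ h) n
    ≡⟨ cong₂ (λ x y → f 0 * x + y) (⊛-comm g h (suc n)) (⊛-right-comm (f ∘ suc) g h n) ⟩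
  f 0 * (h ⊛ g) (suc n) + (((f ∘ suc) ⊛ h) ⊛ g) n
    ≡⟨ lemma₁ (f 0) (h 0) (g (suc n)) (((h ∘ suc) ⊛ g) n) ((((f ∘ suc) ⊛ h) ⊛ g) n) ⟨
  f 0 * h 0 * g (suc n) + (f 0 * ((h ∘ suc) ⊛ g) n + (((f ∘ suc) ⊛ h) ⊛ g) n)
    ≡⟨ cong (_+_ (f 0 * h 0 * g (suc n))) (⊛-linearʳ (f 0) (h ∘ suc) ((f ∘ suc) ⊛ h) g n) ⟨
  f 0 * h 0 * g (suc n) + (((f ⊛ h) ∘ suc) ⊛ g) n ∎
  where
  open ≡-Reasoning
  lemma₁ : ∀ x y z u v → x * y * z + (x * u + v) ≡ x * (y * z + u) + v
  lemma₁ = solve-∀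

-- The Leibniz rule, by writing f = f 0 + x f₁: the derivative of x f₁ g is f₁ g + x (f₁ g)′.
∂-⊛ : ∀ f g n → ∂ (f ⊛ g) n ≡ (∂ f ⊛ g) n + (f ⊛ ∂ g) n
∂-⊛ f g zero    = lemma (f 0) (f 1) (g 0) (g 1)
  where
  lemma : ∀ x x′ y y′ → 1ℤ * (x * y′ + x′ * y) ≡ 1ℤ * x′ * y + x * (1ℤ * y′)
  lemma = solve-∀
∂-⊛ f g (suc n) = begin
  (1ℤ + m) * (f 0 * g (suc (suc n)) + (f₁ ⊛ g) (suc n))
    ≡⟨ lemma₁ m (f 0) (g (suc (suc n))) ((f₁ ⊛ g) (suc n)) ⟩
  f 0 * ∂ g (suc n) + (f₁ ⊛ g) (suc n) + ∂ (f₁ ⊛ g) n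
    ≡⟨ cong (_+_ (f 0 * ∂ g (suc n) + (f₁ ⊛ g) (suc n))) (∂-⊛ f₁ g n) ⟩
  f 0 * ∂ g (suc n) + (f₁ 0 * g (suc n) + ((f₁ ∘ suc) ⊛ g) n) + ((∂ f₁ ⊛ g) n + (f₁ ⊛ ∂ g) n)
    ≡⟨ lemma₂ (f 0 * ∂ g (suc n)) (f₁ 0) (g (suc n)) (((f₁ ∘ suc) ⊛ g) n) ((∂ f₁ ⊛ g) n) ((f₁ ⊛ ∂ g) n) ⟩
  ∂ f 0 * g (suc n) + (1ℤ * ((f₁ ∘ suc) ⊛ g) n + (∂ f₁ ⊛ g) n) + (f ⊛ ∂ g) (suc n)
    ≡⟨ cong (λ x → ∂ f 0 * g (suc n) + x + (f ⊛ ∂ g) (suc n))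
         (⊛-linearʳ 1ℤ (f₁ ∘ suc) (∂ f₁) g n) ⟨
  ∂ f 0 * g (suc n) + ((λ i → 1ℤ * f₁ (suc i) + ∂ f₁ i) ⊛ g) n + (f ⊛ ∂ g) (suc n)
    ≡⟨ cong (λ x → ∂ f 0 * g (suc n) + x + (f ⊛ ∂ g) (suc n))
         (⊛-congʳ g (λ i → lemma₃ (+ suc i) (f₁ (suc i))) n) ⟩
  (∂ f ⊛ g) (suc n) + (f ⊛ ∂ g) (suc n) ∎
  where
  open ≡-Reasoning
  f₁ = f ∘ suc
  -- `m` evaluates to `+ suc n`, so `1ℤ + m` is the factor in `∂` at `suc n` and `m` the one at `n`.
  m  = + suc (suc n) + -1ℤ
  lemma₁ : ∀ m x y z → (1ℤ + m) * (x * y + z) ≡ x * ((1ℤ + m) * y) + z + m * z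
  lemma₁ = solve-∀
  lemma₂ : ∀ p x y u v w → p + (x * y + u) + (v + w) ≡ 1ℤ * x * y + (1ℤ * u + v) + (p + w)
  lemma₂ = solve-∀
  lemma₃ : ∀ m x → 1ℤ * x + m * x ≡ (1ℤ + m) * x
  lemma₃ = solve-∀

-- For b n = β (n - 1), the series a is exp (∑ b n xⁿ / n).
IsExp : (ℕ → ℤ) → (ℕ → ℤ) → Set
IsExp β a = a 0 ≡ 1ℤ × (∀ n → ∂ a n ≡ (a ⊛ β) n)

HasExp : (ℕ → ℤ) → Set
HasExp β = Σ[ a ∈ (ℕ → ℤ) ] IsExp β a

hasExp-cong : ∀ {β β′} → β ≗ β′ → HasExp β → HasExp β′
hasExp-cong β≗ (a , a₀ , ∂a) = a , a₀ , λ n → trans (∂a n) (⊛-congˡ a β≗ n)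

-- The exponential of a sum is the product: by the Leibniz rule, logarithmic derivatives add.
hasExp-+ : ∀ {β γ} → HasExp β → HasExp γ → HasExp (λ n → β n + γ n)
hasExp-+ {β} {γ} (a , a₀ , ∂a) (c , c₀ , ∂c) = a ⊛ c , cong₂ _*_ a₀ c₀ , λ n → begin
  ∂ (a ⊛ c) n                            ≡⟨ ∂-⊛ a c n ⟩
  (∂ a ⊛ c) n + (a ⊛ ∂ c) n              ≡⟨ cong₂ _+_ (⊛-congʳ c ∂a n) (⊛-comm a (∂ c) n) ⟩
  (a ⊛ β ⊛ c) n + (∂ c ⊛ a) n            ≡⟨ cong₂ _+_ (⊛-right-comm a β c n) (⊛-congʳ a ∂c n) ⟩
  (a ⊛ c ⊛ β) n + (c ⊛ γ ⊛ a) n          ≡⟨ cong (_+_ ((a ⊛ c ⊛ β) n)) (⊛-right-comm c γ a n) ⟩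
  (a ⊛ c ⊛ β) n + (c ⊛ a ⊛ γ) n          ≡⟨ cong₂ _+_ (sym (ℤ.*-identityˡ ((a ⊛ c ⊛ β) n))) (⊛-congʳ γ (⊛-comm c a) n) ⟩
  1ℤ * (a ⊛ c ⊛ β) n + (a ⊛ c ⊛ γ) n     ≡⟨ ⊛-linearˡ 1ℤ β γ (a ⊛ c) n ⟨
  (a ⊛ c ⊛ (λ i → 1ℤ * β i + γ i)) n     ≡⟨ ⊛-congˡ (a ⊛ c) (λ i → cong (_+ γ i) (ℤ.*-identityˡ (β i))) n ⟩
  (a ⊛ c ⊛ (λ i → β i + γ i)) n          ∎
  where open ≡-Reasoning

-- The n-th coefficient has n + 1 terms, all equal since each depends only on the sum of its
-- indices.
⊛-const : ∀ f g h → (∀ i j → f i * g j ≡ h (i ℕ.+ j)) → ∀ n → (f ⊛ g) n ≡ + suc n * h n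
⊛-const f g h fg≡h zero    = trans (fg≡h 0 0) (sym (ℤ.*-identityˡ (h 0)))
⊛-const f g h fg≡h (suc n) = trans
  (cong₂ _+_ (fg≡h 0 (suc n)) (⊛-const (f ∘ suc) g (h ∘ suc) (fg≡h ∘ suc) n))
  (lemma (+ suc n) (h (suc n)))
  where
  lemma : ∀ m x → x + m * x ≡ (1ℤ + m) * x
  lemma = solve-∀

-- The exponential is 1 / (1 - q x), as ∑ qⁿ xⁿ / n = - log (1 - q x).
hasExp-^ : ∀ q → HasExp (λ n → q ^ suc n)
hasExp-^ q = (q ^_) , refl , λ n → sym (⊛-const (q ^_) (λ i → q ^ suc i) (λ i → q ^ suc i)
  (λ i j → begin
    q ^ i * (q * q ^ j)  ≡⟨ lemma (q ^ i) q (q ^ j) ⟩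
    q * (q ^ i * q ^ j)  ≡⟨ cong (q *_) (ℤ.^-distribˡ-+-* q i j) ⟨
    q ^ suc (i ℕ.+ j)    ∎) n)
  where
  open ≡-Reasoning
  lemma : ∀ x y z → x * (y * z) ≡ y * (x * z)
  lemma = solve-∀

-- Monomials c xʲ and polynomials 1 + c xʲ⁺¹

spike : ℤ → ℕ → ℕ → ℤ
spike c zero    zero    = c
spike c zero    (suc n) = 0ℤ
spike c (suc j) zero    = 0ℤ
spike c (suc j) (suc n) = spike c j n

spike-< : ∀ c {j n} → n < j → spike c j n ≡ 0ℤ
spike-< c {suc j} {zero}  _         = refl
spike-< c {suc j} {suc n} (s≤s n<j) = spike-< c n<j

spike-≡ : ∀ c j → spike c j j ≡ c
spike-≡ c zero    = refl
spike-≡ c (suc j) = spike-≡ c j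

spike-> : ∀ c j k → spike c j (suc (j ℕ.+ k)) ≡ 0ℤ
spike-> c zero    k = refl
spike-> c (suc j) k = spike-> c j k

⊛-zeroˡ : ∀ f g → (∀ i → f i ≡ 0ℤ) → ∀ n → (f ⊛ g) n ≡ 0ℤ
⊛-zeroˡ f g f≡0 zero    = cong (_* g 0) (f≡0 0)
⊛-zeroˡ f g f≡0 (suc n) = cong₂ _+_ (cong (_* g (suc n)) (f≡0 0)) (⊛-zeroˡ (f ∘ suc) g (f≡0 ∘ suc) n)

spike-⊛-< : ∀ c g {j n} → n < j → (spike c j ⊛ g) n ≡ 0ℤ
spike-⊛-< c g {suc j} {zero}  _         = refl
spike-⊛-< c g {suc j} {suc n} (s≤s n<j) = cong (_+_ 0ℤ) (spike-⊛-< c g n<j)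

spike-⊛-+ : ∀ c g j k → (spike c j ⊛ g) (j ℕ.+ k) ≡ c * g k
spike-⊛-+ c g zero    zero    = refl
spike-⊛-+ c g zero    (suc k) =
  trans (cong (_+_ (c * g (suc k))) (⊛-zeroˡ (spike c 0 ∘ suc) g (λ _ → refl) k)) (ℤ.+-identityʳ _)
spike-⊛-+ c g (suc j) k       = trans (ℤ.+-identityˡ _) (spike-⊛-+ c g j k)

-- The exponent of the second term is one more than the index `j`.
1+spike : ℤ → ℕ → ℕ → ℤ
1+spike c j zero    = 1ℤ
1+spike c j (suc n) = spike c j n

1+spike-⊛-≤ : ∀ c g {j n} → n ≤ j → (1+spike c j ⊛ g) n ≡ g n
1+spike-⊛-≤ c g {j} {zero}  _   = ℤ.*-identityˡ (g 0)
1+spike-⊛-≤ c g {j} {suc n} n<j = trans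
  (cong₂ _+_ (ℤ.*-identityˡ (g (suc n))) (spike-⊛-< c g n<j)) (ℤ.+-identityʳ _)

1+spike-⊛-> : ∀ c g j k → (1+spike c j ⊛ g) (suc (j ℕ.+ k)) ≡ g (suc (j ℕ.+ k)) + c * g k
1+spike-⊛-> c g j k = cong₂ _+_ (ℤ.*-identityˡ (g (suc (j ℕ.+ k)))) (spike-⊛-+ c g j k)

-- The exponential is 1 - q x, the inverse of the geometric series.
hasExp-neg-^ : ∀ q → HasExp (λ n → - (q ^ suc n))
hasExp-neg-^ q = 1+spike (- q) 0 , refl , ∂-1-qx
  where
  lemma₁ : ∀ q → 1ℤ * - q ≡ 1ℤ * - (q * 1ℤ)
  lemma₁ = solve-∀
  lemma₂ : ∀ x y → - (x * y) + - x * - y ≡ 0ℤ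
  lemma₂ = solve-∀
  ∂-1-qx : ∀ n → ∂ (1+spike (- q) 0) n ≡ (1+spike (- q) 0 ⊛ (λ i → - (q ^ suc i))) n
  ∂-1-qx zero    = lemma₁ q
  ∂-1-qx (suc n) = trans (ℤ.*-zeroʳ (+ suc (suc n)))
    (sym (trans (1+spike-⊛-> (- q) (λ i → - (q ^ suc i)) 0 n) (lemma₂ q (q ^ suc n))))

-- The number of fixed points of the (n+1)-st power of a cycle of length j+1.
cycleFix : ℕ → ℕ → ℕ
cycleFix j n = if does (suc j ∣? suc n) then suc j else 0

cycleFix-∣ : ∀ {j n} → suc j ∣ suc n → cycleFix j n ≡ suc j
cycleFix-∣ {j} {n} d = cong (if_then suc j else 0) (dec-true (suc j ∣? suc n) d)

cycleFix-∤ : ∀ {j n} → ¬ suc j ∣ suc n → cycleFix j n ≡ 0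
cycleFix-∤ {j} {n} ¬d = cong (if_then suc j else 0) (dec-false (suc j ∣? suc n) ¬d)

cycleFix-< : ∀ {j n} → n < j → cycleFix j n ≡ 0
cycleFix-< n<j = cycleFix-∤ (λ d → ℕ.<⇒≱ (s≤s n<j) (∣⇒≤ d))

cycleFix-periodic : ∀ j k → cycleFix j (suc (j ℕ.+ k)) ≡ cycleFix j k
cycleFix-periodic j k = by-cases (suc j ∣? suc k)
  where
  shift : suc j ℕ.+ suc k ≡ suc (suc (j ℕ.+ k))
  shift = ℕ.+-suc (suc j) k
  by-cases : Dec (suc j ∣ suc k) → cycleFix j (suc (j ℕ.+ k)) ≡ cycleFix j k
  by-cases (yes d) = trans
    (cycleFix-∣ {j} (subst (suc j ∣_) shift (∣m∣n⇒∣m+n ∣-refl d))) (sym (cycleFix-∣ d))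
  by-cases (no ¬d) = trans
    (cycleFix-∤ {j} (λ d → ¬d (∣m+n∣m⇒∣n (subst (suc j ∣_) (sym shift) d) ∣-refl))) (sym (cycleFix-∤ ¬d))

-- The exponential is 1 - xʲ⁺¹, the inverse zeta function of one cycle. Its derivative lives in
-- degree j only; in higher degrees the two terms of the product cancel because `cycleFix j` has
-- period j + 1.
hasExp-neg-cycleFix : ∀ j → HasExp (λ n → - + cycleFix j n)
hasExp-neg-cycleFix j = 1+spike -1ℤ j , refl , λ n → by-cases n (ℕ.<-cmp n j)
  where
  open ≡-Reasoning
  β = λ n → - + cycleFix j n
  lemma : ∀ x → - x + -1ℤ * - x ≡ 0ℤ
  lemma = solve-∀
  by-cases : ∀ n → _ → ∂ (1+spike -1ℤ j) n ≡ (1+spike -1ℤ j ⊛ β) n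
  by-cases n (tri< n<j _ _)  = begin
    + suc n * spike -1ℤ j n     ≡⟨ cong (+ suc n *_) (spike-< -1ℤ n<j) ⟩
    + suc n * 0ℤ                ≡⟨ ℤ.*-zeroʳ (+ suc n) ⟩
    0ℤ                          ≡⟨ cong (λ x → - + x) (cycleFix-< n<j) ⟨
    β n                         ≡⟨ 1+spike-⊛-≤ -1ℤ β (ℕ.<⇒≤ n<j) ⟨
    (1+spike -1ℤ j ⊛ β) n       ∎
  by-cases n (tri≈ _ refl _) = begin
    + suc n * spike -1ℤ n n     ≡⟨ cong (+ suc n *_) (spike-≡ -1ℤ n) ⟩
    + suc n * -1ℤ               ≡⟨ ℤ.*-comm (+ suc n) -1ℤ ⟩
    -1ℤ * + suc n               ≡⟨ ℤ.-1*i≡-i (+ suc n) ⟩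
    - + suc n                   ≡⟨ cong (λ x → - + x) (cycleFix-∣ {n} ∣-refl) ⟨
    β n                         ≡⟨ 1+spike-⊛-≤ -1ℤ β {n} ℕ.≤-refl ⟨
    (1+spike -1ℤ n ⊛ β) n       ∎
  by-cases n (tri> _ _ j<n) with ℕ.m≤n⇒∃[o]m+o≡n j<n
  ... | k , refl = begin
    + suc n * spike -1ℤ j n     ≡⟨ cong (+ suc n *_) (spike-> -1ℤ j k) ⟩
    + suc n * 0ℤ                ≡⟨ ℤ.*-zeroʳ (+ suc n) ⟩
    0ℤ                          ≡⟨ lemma (+ cycleFix j k) ⟨
    β k + -1ℤ * β k             ≡⟨ cong (λ x → - + x + -1ℤ * β k) (cycleFix-periodic j k) ⟨
    β n + -1ℤ * β k             ≡⟨ 1+spike-⊛-> -1ℤ β j k ⟨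
    (1+spike -1ℤ j ⊛ β) n       ∎

-- The equation for the derivative determines n + 1 times coefficient n + 1 from the earlier
-- coefficients and from β up to n, and n + 1 can be cancelled in ℤ.
isExp-unique : ∀ {β β′ a a′} K → (∀ n → n < K → β n ≡ β′ n) → IsExp β a → IsExp β′ a′ →
               ∀ n → n ≤ K → a n ≡ a′ n
isExp-unique {β} {β′} {a} {a′} K β≡ (a₀ , ∂a) (a′₀ , ∂a′) n = below n n ℕ.≤-refl
  where
  open ≡-Reasoning
  -- The bound `m` on `n` turns strong induction into structural recursion.
  below : ∀ m n → n ≤ m → n ≤ K → a n ≡ a′ n
  below m       zero    _         _   = trans a₀ (sym a′₀)
  below (suc m) (suc n) (s≤s n≤m) n<K = ℤ.*-cancelˡ-≡ (+ suc n) _ _ (begin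
    ∂ a n          ≡⟨ ∂a n ⟩
    (a ⊛ β) n      ≡⟨ ⊛-cong-≤ {a} {a′} {β} {β′} n
                        (λ i i≤n → below m i (ℕ.≤-trans i≤n n≤m) (ℕ.≤-trans i≤n (ℕ.<⇒≤ n<K)))
                        (λ i i≤n → β≡ i (ℕ.≤-<-trans i≤n n<K)) ⟩
    (a′ ⊛ β′) n    ≡⟨ ∂a′ n ⟨
    ∂ a′ n         ∎)

-- Coefficient n of an exponential depends only on β below n, so the diagonal of the approximating
-- exponentials is an exponential of β.
hasExp-limit : ∀ {β} → (∀ K → Σ[ γ ∈ (ℕ → ℤ) ] HasExp γ × (∀ n → n < K → γ n ≡ β n)) → HasExp β
hasExp-limit {β} approx = a , proj₁ (a-isExp 0) , λ n → begin
  ∂ a n                       ≡⟨ proj₂ (a-isExp (suc n)) n ⟩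
  (A (suc n) ⊛ γ (suc n)) n   ≡⟨ ⊛-cong-≤ {A (suc n)} {a} {γ (suc n)} {β} n
                                   (λ i i≤n → isExp-unique {γ (suc n)} {γ i} i
                                     (λ k k<i → trans (γ≡β (suc n) k (ℕ.<-trans k<i (s≤s i≤n))) (sym (γ≡β i k k<i)))
                                     (a-isExp (suc n)) (a-isExp i) i ℕ.≤-refl)
                                   (λ i i≤n → γ≡β (suc n) i (s≤s i≤n)) ⟩
  (a ⊛ β) n                   ∎
  where
  open ≡-Reasoning
  γ : ℕ → ℕ → ℤ
  γ K = proj₁ (approx K)
  A : ℕ → ℕ → ℤ
  A K = proj₁ (proj₁ (proj₂ (approx K)))
  a-isExp : ∀ K → IsExp (γ K) (A K)
  a-isExp K = proj₂ (proj₁ (proj₂ (approx K)))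
  γ≡β : ∀ K n → n < K → γ K n ≡ β n
  γ≡β K = proj₂ (proj₂ (approx K))
  a : ℕ → ℤ
  a n = A n n

-- From exponentials to Newton-Euler pairs

⊛-suc-sum : ∀ (f b : ℕ → ℤ) n → (f ⊛ (b ∘ suc)) n ≡ ∑[ i < suc n ] (f (toℕ i) * b (suc n ∸ toℕ i))
⊛-suc-sum f b zero    = sym (ℤ.+-identityʳ (f 0 * b 1))
⊛-suc-sum f b (suc n) = cong (_+_ (f 0 * b (suc (suc n)))) (⊛-suc-sum (f ∘ suc) b n)

-- Coefficient n of the equation for the derivative is the Newton relation for n + 1; the term with
-- `a 0` = 1 supplies the isolated term of `b`.
hasExp⇒newtonEuler : ∀ b → HasExp (b ∘ suc) → NewtonEulerSequence b
hasExp⇒newtonEuler b (a , a₀ , ∂a) = a , a₁≡b₁ , newton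
  where
  open ≡-Reasoning
  a₁≡b₁ : a 1 ≡ b 1
  a₁≡b₁ = begin
    a 1        ≡⟨ ℤ.*-identityˡ (a 1) ⟨
    ∂ a 0      ≡⟨ ∂a 0 ⟩
    a 0 * b 1  ≡⟨ cong (_* b 1) a₀ ⟩
    1ℤ * b 1   ≡⟨ ℤ.*-identityˡ (b 1) ⟩
    b 1        ∎
  newton : ∀ n → n ℕ.> 1 → b n + (∑[ i < n ∸ 1 ] (a (suc (toℕ i)) * b (n ∸ suc (toℕ i)))) ≡ + n * a n
  newton (suc n) _ = begin
    b (suc n) + s         ≡⟨ cong (_+ s) (ℤ.*-identityˡ (b (suc n))) ⟨
    1ℤ * b (suc n) + s    ≡⟨ cong (λ x → x * b (suc n) + s) a₀ ⟨
    a 0 * b (suc n) + s   ≡⟨ ⊛-suc-sum a b n ⟨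
    (a ⊛ (b ∘ suc)) n     ≡⟨ ∂a n ⟨
    ∂ a n                 ∎
    where
    s = ∑[ i < n ] (a (suc (toℕ i)) * b (suc n ∸ suc (toℕ i)))

-- Integrality of exp (∑ (±1)ⁿ U 2n xⁿ / n)

V : ℕ → ℤ
V n = U (2 ℕ.* n)

V-rec : ∀ n → V (suc n) ≡
        - (+ 2) * (∑[ i < suc n ] (+ (2 ℕ.* suc n C 2 ℕ.* suc (toℕ i)) * V (n ∸ toℕ i)))
V-rec n = begin
  V (suc n)
    ≡⟨ U-rec (2 ℕ.* suc n) (s≤s z≤n) ⟩
  - (+ 2) * s ((2 ℕ.* suc n) ℕ./ 2)
    ≡⟨ cong (λ k → - (+ 2) * s k) (trans (cong (ℕ._/ 2) (ℕ.*-comm 2 (suc n))) (m*n/n≡m (suc n) 2)) ⟩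
  - (+ 2) * s (suc n)
    ≡⟨ cong (- (+ 2) *_) (sum-cong-≗ {suc n} (λ i →
         cong (λ m → + (2 ℕ.* suc n C 2 ℕ.* suc (toℕ i)) * U m)
              (sym (ℕ.*-distribˡ-∸ 2 (suc n) (suc (toℕ i)))))) ⟩
  - (+ 2) * (∑[ i < suc n ] (+ (2 ℕ.* suc n C 2 ℕ.* suc (toℕ i)) * V (n ∸ toℕ i))) ∎
  where
  open ≡-Reasoning
  s : ℕ → ℤ
  s k = ∑[ i < k ] (+ (2 ℕ.* suc n C 2 ℕ.* suc (toℕ i)) * U (2 ℕ.* suc n ∸ 2 ℕ.* suc (toℕ i)))

-- Binomial sums over even indices and the second difference

^≡ : ∀ x n → x Exp.^ n ≡ x ^ n
^≡ x zero    = refl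
^≡ x (suc n) = cong (x *_) (^≡ x n)

×≡ : ∀ n x → n Mult.× x ≡ + n * x
×≡ zero    x = refl
×≡ (suc n) x = trans (cong (_+_ x) (×≡ n x)) (lemma (+ n) x)
  where
  lemma : ∀ m x → x + m * x ≡ (1ℤ + m) * x
  lemma = solve-∀

binomial : ∀ n x y → (x + y) ^ n ≡ ∑[ k < suc n ] (+ (n C toℕ k) * (x ^ toℕ k * y ^ (n ∸ toℕ k)))
binomial n x y = begin
  (x + y) ^ n       ≡⟨ ^≡ (x + y) n ⟨
  (x + y) Exp.^ n   ≡⟨ Binomial.theorem n x y ⟩
  _                 ≡⟨ sum-cong-≗ {suc n} (λ k → trans (×≡ (n C toℕ k) _)
                         (cong₂ (λ u v → + (n C toℕ k) * (u * v)) (^≡ x (toℕ k)) (^≡ y (n ∸ toℕ k)))) ⟩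
  (∑[ k < suc n ] (+ (n C toℕ k) * (x ^ toℕ k * y ^ (n ∸ toℕ k)))) ∎
  where open ≡-Reasoning

sum-even : ∀ n (g : ℕ → ℤ) → (∀ k → g (suc (2 ℕ.* k)) ≡ 0ℤ) →
           ∑[ k < suc (2 ℕ.* n) ] g (toℕ k) ≡ ∑[ k < suc n ] g (2 ℕ.* toℕ k)
sum-even zero    g g-odd = refl
sum-even (suc n) g g-odd = begin
  g 0 + s (2 ℕ.* suc n) (g ∘ suc)                      ≡⟨ cong (λ m → g 0 + s m (g ∘ suc)) (ℕ.*-suc 2 n) ⟩
  g 0 + (g 1 + s (suc (2 ℕ.* n)) (λ k → g (suc (suc k))))
    ≡⟨ cong₂ (λ u v → g 0 + (u + v)) (g-odd 0) (sum-even n (λ k → g (suc (suc k)))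
         (λ k → trans (cong (g ∘ suc) (sym (ℕ.*-suc 2 k))) (g-odd (suc k)))) ⟩
  g 0 + (0ℤ + (∑[ k < suc n ] g (suc (suc (2 ℕ.* toℕ k)))))
    ≡⟨ cong (_+_ (g 0)) (trans (ℤ.+-identityˡ _)
         (sum-cong-≗ {suc n} (λ k → cong g (sym (ℕ.*-suc 2 (toℕ k)))))) ⟩
  g 0 + (∑[ k < suc n ] g (2 ℕ.* suc (toℕ k)))         ∎
  where
  open ≡-Reasoning
  s : ℕ → (ℕ → ℤ) → ℤ
  s m f = ∑[ k < m ] f (toℕ k)

-1^2k≡1 : ∀ k → -1ℤ ^ (2 ℕ.* k) ≡ 1ℤ
-1^2k≡1 k = trans (sym (ℤ.^-*-assoc -1ℤ 2 k)) (ℤ.^-zeroˡ k)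

-- The second central difference. The doubling is written as a sum, so that closure under sums and
-- negation covers it.
δ² : (ℤ → ℤ) → ℤ → ℤ
δ² f x = (f (1ℤ + x) + f (-1ℤ + x)) - (f x + f x)

-- In the two binomial expansions the odd terms cancel and the even ones double; subtracting 2 x²ⁿ
-- removes the zeroth term. What remains has the coefficients of the recurrence for `V`.
δ²-^ : ∀ n x → δ² (_^ (2 ℕ.* n)) x ≡
       + 2 * (∑[ i < n ] (+ (2 ℕ.* n C 2 ℕ.* suc (toℕ i)) * x ^ (2 ℕ.* (n ∸ suc (toℕ i)))))
δ²-^ n x = begin
  ((1ℤ + x) ^ N + (-1ℤ + x) ^ N) - (x ^ N + x ^ N)
    ≡⟨ cong₂ (λ u v → (u + v) - (x ^ N + x ^ N)) (binomial N 1ℤ x) (binomial N -1ℤ x) ⟩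
  (∑[ k < suc N ] t 1ℤ (toℕ k) + ∑[ k < suc N ] t -1ℤ (toℕ k)) - (x ^ N + x ^ N)
    ≡⟨ cong (_- (x ^ N + x ^ N)) (∑-distrib-+ {suc N} (t 1ℤ ∘ toℕ) (t -1ℤ ∘ toℕ)) ⟨
  (∑[ k < suc N ] (t 1ℤ (toℕ k) + t -1ℤ (toℕ k))) - (x ^ N + x ^ N)
    ≡⟨ cong (_- (x ^ N + x ^ N)) (sum-even n (λ k → t 1ℤ k + t -1ℤ k) odd-terms) ⟩
  ((t 1ℤ 0 + t -1ℤ 0) + (∑[ i < n ] (t 1ℤ (2 ℕ.* suc (toℕ i)) + t -1ℤ (2 ℕ.* suc (toℕ i))))) - (x ^ N + x ^ N)
    ≡⟨ cong (λ s → ((t 1ℤ 0 + t -1ℤ 0) + s) - (x ^ N + x ^ N))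
         (trans (sum-cong-≗ {n} (λ i → even-terms (toℕ i)))
                (sym (*-distribˡ-sum {n} (+ 2) (λ i → u (toℕ i))))) ⟩
  ((t 1ℤ 0 + t -1ℤ 0) + + 2 * (∑[ i < n ] u (toℕ i))) - (x ^ N + x ^ N)
    ≡⟨ lemma₂ (x ^ N) (∑[ i < n ] u (toℕ i)) ⟩
  + 2 * (∑[ i < n ] u (toℕ i)) ∎
  where
  open ≡-Reasoning
  N = 2 ℕ.* n
  t : ℤ → ℕ → ℤ
  t e k = + (N C k) * (e ^ k * x ^ (N ∸ k))
  u : ℕ → ℤ
  u i = + (N C 2 ℕ.* suc i) * x ^ (2 ℕ.* (n ∸ suc i))
  lemma₁ : ∀ c y → c * (1ℤ * y) + c * (-1ℤ * y) ≡ 0ℤ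
  lemma₁ = solve-∀
  lemma₂ : ∀ y s → ((1ℤ * (1ℤ * y) + 1ℤ * (1ℤ * y)) + + 2 * s) - (y + y) ≡ + 2 * s
  lemma₂ = solve-∀
  lemma₃ : ∀ c y → c * (1ℤ * y) + c * (1ℤ * y) ≡ + 2 * (c * y)
  lemma₃ = solve-∀
  odd-terms : ∀ k → t 1ℤ (suc (2 ℕ.* k)) + t -1ℤ (suc (2 ℕ.* k)) ≡ 0ℤ
  odd-terms k = trans
    (cong₂ (λ p q → c * (p * y) + c * (q * y)) (ℤ.^-zeroˡ (suc (2 ℕ.* k))) (cong (-1ℤ *_) (-1^2k≡1 k)))
    (lemma₁ c y)
    where
    c = + (N C suc (2 ℕ.* k))
    y = x ^ (N ∸ suc (2 ℕ.* k))
  even-terms : ∀ i → t 1ℤ (2 ℕ.* suc i) + t -1ℤ (2 ℕ.* suc i) ≡ + 2 * u i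
  even-terms i = begin
    t 1ℤ (2 ℕ.* suc i) + t -1ℤ (2 ℕ.* suc i)
      ≡⟨ cong₂ (λ p q → c * (p * y) + c * (q * y)) (ℤ.^-zeroˡ (2 ℕ.* suc i)) (-1^2k≡1 (suc i)) ⟩
    c * (1ℤ * y) + c * (1ℤ * y)
      ≡⟨ lemma₃ c y ⟩
    + 2 * (c * y)
      ≡⟨ cong (λ m → + 2 * (c * x ^ m)) (ℕ.*-distribˡ-∸ 2 n (suc i)) ⟨
    + 2 * u i ∎
    where
    c = + (N C 2 ℕ.* suc i)
    y = x ^ (N ∸ 2 ℕ.* suc i)

-- Truncation of ∑ₖ (-1)ᵏ (δ²ᵏ f)(0): the recurrence for U says that U n = φ (xⁿ), where φ inverts
-- 1 + δ² and then evaluates at 0, and δ² is nilpotent on polynomials.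
ψ : ℕ → (ℤ → ℤ) → ℤ
ψ zero    f = f 0ℤ
ψ (suc K) f = f 0ℤ - ψ K (δ² f)

ψ-cong : ∀ K {f g} → f ≗ g → ψ K f ≡ ψ K g
ψ-cong zero    f≗g = f≗g 0ℤ
ψ-cong (suc K) f≗g = cong₂ _-_ (f≗g 0ℤ) (ψ-cong K (λ x →
  cong₂ _-_ (cong₂ _+_ (f≗g (1ℤ + x)) (f≗g (-1ℤ + x))) (cong₂ _+_ (f≗g x) (f≗g x))))

ψ-linear : ∀ K c f g → ψ K (λ x → c * f x + g x) ≡ c * ψ K f + ψ K g
ψ-linear zero    c f g = refl
ψ-linear (suc K) c f g = begin
  (c * f 0ℤ + g 0ℤ) - ψ K (δ² (λ x → c * f x + g x))
    ≡⟨ cong (λ z → (c * f 0ℤ + g 0ℤ) - z) (trans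
         (ψ-cong K (λ x → δ²-linear c (f (1ℤ + x)) (f (-1ℤ + x)) (f x) (g (1ℤ + x)) (g (-1ℤ + x)) (g x)))
         (ψ-linear K c (δ² f) (δ² g))) ⟩
  (c * f 0ℤ + g 0ℤ) - (c * ψ K (δ² f) + ψ K (δ² g))
    ≡⟨ lemma c (f 0ℤ) (g 0ℤ) (ψ K (δ² f)) (ψ K (δ² g)) ⟩
  c * (f 0ℤ - ψ K (δ² f)) + (g 0ℤ - ψ K (δ² g)) ∎
  where
  open ≡-Reasoning
  δ²-linear : ∀ c u v w x y z → ((c * u + x) + (c * v + y)) - ((c * w + z) + (c * w + z)) ≡
              c * ((u + v) - (w + w)) + ((x + y) - (z + z))
  δ²-linear = solve-∀
  lemma : ∀ c x y u v → (c * x + y) - (c * u + v) ≡ c * (x - u) + (y - v)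
  lemma = solve-∀

ψ-0 : ∀ K → ψ K (λ _ → 0ℤ) ≡ 0ℤ
ψ-0 zero    = refl
ψ-0 (suc K) = cong (λ z → 0ℤ - z) (ψ-0 K)

ψ-* : ∀ K c f → ψ K (λ x → c * f x) ≡ c * ψ K f
ψ-* K c f = begin
  ψ K (λ x → c * f x)             ≡⟨ ψ-cong K (λ x → sym (ℤ.+-identityʳ (c * f x))) ⟩
  ψ K (λ x → c * f x + 0ℤ)        ≡⟨ ψ-linear K c f (λ _ → 0ℤ) ⟩
  c * ψ K f + ψ K (λ _ → 0ℤ)      ≡⟨ cong (_+_ (c * ψ K f)) (ψ-0 K) ⟩
  c * ψ K f + 0ℤ                  ≡⟨ ℤ.+-identityʳ _ ⟩
  c * ψ K f                       ∎
  where open ≡-Reasoning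

ψ-sum : ∀ K n (c : Fin n → ℤ) (f : Fin n → ℤ → ℤ) → ψ K (λ x → ∑[ i < n ] (c i * f i x)) ≡ ∑[ i < n ] (c i * ψ K (f i))
ψ-sum K zero    c f = ψ-0 K
ψ-sum K (suc n) c f = trans
  (ψ-linear K (c Fin.zero) (f Fin.zero) (λ x → ∑[ i < n ] (c (Fin.suc i) * f (Fin.suc i) x)))
  (cong (_+_ (c Fin.zero * ψ K (f Fin.zero))) (ψ-sum K n (c ∘ Fin.suc) (f ∘ Fin.suc)))

-- By `δ²-^`, one step of `ψ` on a positive even power reproduces the recurrence for `V`, the value
-- at 0 being 0. Each step lowers the degree by at least 2, so K steps are enough for exponents up
-- to 2K.
ψ-V : ∀ K n → n ≤ K → ψ K (_^ (2 ℕ.* n)) ≡ V n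
ψ-V zero    zero    _         = refl
ψ-V (suc K) zero    _         = cong (λ z → 1ℤ - z) (ψ-0 K)
ψ-V (suc K) (suc n) (s≤s n≤K) = begin
  0ℤ - ψ K (δ² (_^ (2 ℕ.* suc n)))
    ≡⟨ cong (λ z → 0ℤ - z) (ψ-cong K (δ²-^ (suc n))) ⟩
  0ℤ - ψ K (λ x → + 2 * (∑[ i < suc n ] (c (toℕ i) * x ^ (2 ℕ.* (n ∸ toℕ i)))))
    ≡⟨ cong (λ z → 0ℤ - z) (ψ-* K (+ 2) (λ x → ∑[ i < suc n ] (c (toℕ i) * x ^ (2 ℕ.* (n ∸ toℕ i))))) ⟩
  0ℤ - + 2 * ψ K (λ x → ∑[ i < suc n ] (c (toℕ i) * x ^ (2 ℕ.* (n ∸ toℕ i))))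
    ≡⟨ cong (λ z → 0ℤ - + 2 * z)
         (trans (ψ-sum K (suc n) (λ i → c (toℕ i)) (λ i x → x ^ (2 ℕ.* (n ∸ toℕ i))))
                (sum-cong-≗ {suc n} (λ i → cong (c (toℕ i) *_)
                  (ψ-V K (n ∸ toℕ i) (ℕ.≤-trans (ℕ.m∸n≤m n (toℕ i)) n≤K))))) ⟩
  0ℤ - + 2 * (∑[ i < suc n ] (c (toℕ i) * V (n ∸ toℕ i)))
    ≡⟨ lemma (∑[ i < suc n ] (c (toℕ i) * V (n ∸ toℕ i))) ⟩
  - (+ 2) * (∑[ i < suc n ] (c (toℕ i) * V (n ∸ toℕ i)))
    ≡⟨ V-rec n ⟨
  V (suc n) ∎
  where
  open ≡-Reasoning
  c : ℕ → ℤ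
  c i = + (2 ℕ.* suc n C 2 ℕ.* suc i)
  lemma : ∀ x → 0ℤ - + 2 * x ≡ - (+ 2) * x
  lemma = solve-∀

-- `ψ` subtracts, so negatives of sequences are needed; carrying both signs along avoids inverting
-- power series.
HasExp± : (ℕ → ℤ) → Set
HasExp± β = HasExp β × HasExp (-_ ∘ β)

hasExp±-+ : ∀ {β γ} → HasExp± β → HasExp± γ → HasExp± (λ n → β n + γ n)
hasExp±-+ {β} {γ} (b⁺ , b⁻) (c⁺ , c⁻) =
  hasExp-+ b⁺ c⁺ , hasExp-cong (λ n → sym (ℤ.neg-distrib-+ (β n) (γ n))) (hasExp-+ b⁻ c⁻)

hasExp±-neg : ∀ {β} → HasExp± β → HasExp± (-_ ∘ β)
hasExp±-neg {β} (b⁺ , b⁻) = b⁻ , hasExp-cong (λ n → sym (ℤ.neg-involutive (β n))) b⁺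

-- The points at which `ψ K` evaluates `F n`, and their integer weights, are the same for all n, so
-- only sums and negations of the sequences at fixed x occur.
hasExp±-ψ : ∀ K (F : ℕ → ℤ → ℤ) → (∀ x → HasExp± (λ n → F n x)) → HasExp± (λ n → ψ K (F n))
hasExp±-ψ zero    F hF = hF 0ℤ
hasExp±-ψ (suc K) F hF = hasExp±-+ (hF 0ℤ) (hasExp±-neg (hasExp±-ψ K (λ n → δ² (F n)) (λ x →
  hasExp±-+ (hasExp±-+ (hF (1ℤ + x)) (hF (-1ℤ + x))) (hasExp±-neg (hasExp±-+ (hF x) (hF x))))))

^-distribʳ-* : ∀ m x y → (x * y) ^ m ≡ x ^ m * y ^ m
^-distribʳ-* zero    x y = refl
^-distribʳ-* (suc m) x y = trans (cong (x * y *_) (^-distribʳ-* m x y)) (lemma x y (x ^ m) (y ^ m))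
  where
  lemma : ∀ x y u v → x * y * (u * v) ≡ x * u * (y * v)
  lemma = solve-∀

-- Up to any K the sequence is `ψ K` of the powers of s x², an integer combination of sequences qⁿ
-- with q = s x²; the limit removes the bound. It is used for s = 1 and s = -1.
hasExp-twisted-V : ∀ s → HasExp (λ n → s ^ suc n * V (suc n))
hasExp-twisted-V s = hasExp-limit λ K →
  (λ n → ψ K (F n)) , proj₁ (hasExp±-ψ K F (λ x → hasExp-^ (s * x ^ 2) , hasExp-neg-^ (s * x ^ 2))) ,
  λ n n<K → begin
    ψ K (F n)                                  ≡⟨ ψ-cong K (F≡ n) ⟩
    ψ K (λ x → s ^ suc n * x ^ (2 ℕ.* suc n))  ≡⟨ ψ-* K (s ^ suc n) (_^ (2 ℕ.* suc n)) ⟩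
    s ^ suc n * ψ K (_^ (2 ℕ.* suc n))         ≡⟨ cong (s ^ suc n *_) (ψ-V K (suc n) n<K) ⟩
    s ^ suc n * V (suc n)                      ∎
  where
  open ≡-Reasoning
  F : ℕ → ℤ → ℤ
  F n x = (s * x ^ 2) ^ suc n
  F≡ : ∀ n x → F n x ≡ s ^ suc n * x ^ (2 ℕ.* suc n)
  F≡ n x = trans (^-distribʳ-* (suc n) s (x ^ 2)) (cong (s ^ suc n *_) (ℤ.^-*-assoc x 2 (suc n)))

newtonEuler-V : NewtonEulerSequence V
newtonEuler-V = hasExp⇒newtonEuler V (hasExp-cong
  (λ n → trans (cong (_* V (suc n)) (ℤ.^-zeroˡ (suc n))) (ℤ.*-identityˡ _)) (hasExp-twisted-V 1ℤ))

-- Growth of (-1)ⁿ U 2n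

-- The absorption identity, by induction with Pascal's rule.
C-absorb : ∀ n k → suc k ℕ.* (suc n C suc k) ≡ suc n ℕ.* (n C k)
C-absorb n       zero    = trans (ℕ.*-identityˡ _) (trans (nC1≡n (suc n)) (sym (ℕ.*-identityʳ (suc n))))
C-absorb zero    (suc k) = ℕ.*-zeroʳ (suc (suc k))
C-absorb (suc n) (suc k) = begin
  suc (suc k) ℕ.* (suc (suc n) C suc (suc k))
    ≡⟨ cong (suc (suc k) ℕ.*_) (nCk+nC[k+1]≡[n+1]C[k+1] (suc n) (suc k)) ⟨
  suc (suc k) ℕ.* (p ℕ.+ (suc n C suc (suc k)))
    ≡⟨ lemma₁ k p (suc n C suc (suc k)) ⟩
  p ℕ.+ (suc k ℕ.* p ℕ.+ suc (suc k) ℕ.* (suc n C suc (suc k)))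
    ≡⟨ cong₂ (λ u v → p ℕ.+ (u ℕ.+ v)) (C-absorb n k) (C-absorb n (suc k)) ⟩
  p ℕ.+ (suc n ℕ.* (n C k) ℕ.+ suc n ℕ.* (n C suc k))
    ≡⟨ cong (p ℕ.+_) (ℕ.*-distribˡ-+ (suc n) (n C k) (n C suc k)) ⟨
  p ℕ.+ suc n ℕ.* ((n C k) ℕ.+ (n C suc k))
    ≡⟨ cong (λ u → p ℕ.+ suc n ℕ.* u) (nCk+nC[k+1]≡[n+1]C[k+1] n k) ⟩
  suc (suc n) ℕ.* p ∎
  where
  open ≡-Reasoning
  p = suc n C suc k
  lemma₁ : ∀ k p q → suc (suc k) ℕ.* (p ℕ.+ q) ≡ p ℕ.+ (suc k ℕ.* p ℕ.+ suc (suc k) ℕ.* q)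
  lemma₁ = ℕ-Solver.solve-∀

-- Pascal's rule and absorption, with the common term cancelled; the upper index k + d avoids
-- subtraction.
C-ratio : ∀ k d → suc k ℕ.* ((k ℕ.+ d) C suc k) ≡ d ℕ.* ((k ℕ.+ d) C k)
C-ratio k d = ℕ.+-cancelˡ-≡ (suc k ℕ.* p) _ _ (begin
  suc k ℕ.* p ℕ.+ suc k ℕ.* ((k ℕ.+ d) C suc k)   ≡⟨ ℕ.*-distribˡ-+ (suc k) p ((k ℕ.+ d) C suc k) ⟨
  suc k ℕ.* (p ℕ.+ ((k ℕ.+ d) C suc k))           ≡⟨ cong (suc k ℕ.*_) (nCk+nC[k+1]≡[n+1]C[k+1] (k ℕ.+ d) k) ⟩
  suc k ℕ.* (suc (k ℕ.+ d) C suc k)             ≡⟨ C-absorb (k ℕ.+ d) k ⟩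
  (suc k ℕ.+ d) ℕ.* p                           ≡⟨ ℕ.*-distribʳ-+ p (suc k) d ⟩
  suc k ℕ.* p ℕ.+ d ℕ.* p                       ∎)
  where
  open ≡-Reasoning
  p = (k ℕ.+ d) C k

C-ratio₂ : ∀ k d → (suc k ℕ.* suc (suc k)) ℕ.* ((k ℕ.+ suc (suc d)) C suc (suc k)) ≡
           (suc d ℕ.* suc (suc d)) ℕ.* ((k ℕ.+ suc (suc d)) C k)
C-ratio₂ k d = begin
  (suc k ℕ.* suc (suc k)) ℕ.* (N C suc (suc k))
    ≡⟨ ℕ.*-assoc (suc k) (suc (suc k)) (N C suc (suc k)) ⟩
  suc k ℕ.* (suc (suc k) ℕ.* (N C suc (suc k)))
    ≡⟨ cong (suc k ℕ.*_) (subst (λ M → suc (suc k) ℕ.* (M C suc (suc k)) ≡ suc d ℕ.* (M C suc k))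
         (sym (ℕ.+-suc k (suc d))) (C-ratio (suc k) (suc d))) ⟩
  suc k ℕ.* (suc d ℕ.* (N C suc k))
    ≡⟨ lemma (suc k) (suc d) (N C suc k) ⟩
  suc d ℕ.* (suc k ℕ.* (N C suc k))
    ≡⟨ cong (suc d ℕ.*_) (C-ratio k (suc (suc d))) ⟩
  suc d ℕ.* (suc (suc d) ℕ.* (N C k))
    ≡⟨ ℕ.*-assoc (suc d) (suc (suc d)) (N C k) ⟨
  (suc d ℕ.* suc (suc d)) ℕ.* (N C k) ∎
  where
  open ≡-Reasoning
  N = k ℕ.+ suc (suc d)
  lemma : ∀ x y z → x ℕ.* (y ℕ.* z) ≡ y ℕ.* (x ℕ.* z)
  lemma = ℕ-Solver.solve-∀

-- The first coefficient of the recurrence, which becomes the growth factor of `W`.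
2nC2 : ∀ n → 2 ℕ.* suc n C 2 ≡ suc n ℕ.* suc (2 ℕ.* n)
2nC2 n = ℕ.*-cancelˡ-≡ _ _ 2 (begin
  2 ℕ.* (2 ℕ.* suc n C 2)                      ≡⟨ cong (λ N → 2 ℕ.* (N C 2)) (ℕ.*-suc 2 n) ⟩
  2 ℕ.* (suc (suc (2 ℕ.* n)) C 2)              ≡⟨ C-ratio₂ 0 (2 ℕ.* n) ⟩
  (suc (2 ℕ.* n) ℕ.* suc (suc (2 ℕ.* n))) ℕ.* 1   ≡⟨ lemma n ⟩
  2 ℕ.* (suc n ℕ.* suc (2 ℕ.* n))              ∎)
  where
  open ≡-Reasoning
  lemma : ∀ n → (suc (2 ℕ.* n) ℕ.* suc (suc (2 ℕ.* n))) ℕ.* 1 ≡ 2 ℕ.* (suc n ℕ.* suc (2 ℕ.* n))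
  lemma = ℕ-Solver.solve-∀

-- For consecutive values a, b of `w` this compares consecutive terms of the recurrence. With k = 2i
-- + 2 the binomial ratio is (2m+1)(2m+2) / ((k+1)(k+2)); the growth hypothesis absorbs (m+1)(2m+1),
-- leaving 2 / ((k+1)(k+2)), at most 1/2.
C-decay : ∀ i m {a b} → (suc m ℕ.* suc (2 ℕ.* m)) ℕ.* a ≤ b →
          2 ℕ.* ((2 ℕ.* suc (suc i ℕ.+ m) C 2 ℕ.* suc (suc i)) ℕ.* a) ≤
          (2 ℕ.* suc (suc i ℕ.+ m) C 2 ℕ.* suc i) ℕ.* b
C-decay i m {a} {b} growth = ℕ.*-cancelˡ-≤ 2 (begin
  2 ℕ.* (2 ℕ.* ((N C 2 ℕ.* suc (suc i)) ℕ.* a))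
    ≡⟨ cong₂ (λ M L → 2 ℕ.* (2 ℕ.* ((M C L) ℕ.* a))) N≡ (ℕ.*-suc 2 (suc i)) ⟩
  2 ℕ.* (2 ℕ.* (c″ ℕ.* a))
    ≡⟨ lemma₁ c″ a ⟩
  4 ℕ.* (c″ ℕ.* a)
    ≤⟨ ℕ.*-monoˡ-≤ (c″ ℕ.* a) (ℕ.*-mono-≤ {2} {suc k} {2} {suc (suc k)} (s≤s (s≤s z≤n)) (s≤s (s≤s z≤n))) ⟩
  (suc k ℕ.* suc (suc k)) ℕ.* (c″ ℕ.* a)
    ≡⟨ ℕ.*-assoc (suc k ℕ.* suc (suc k)) c″ a ⟨
  (suc k ℕ.* suc (suc k)) ℕ.* c″ ℕ.* a
    ≡⟨ cong (ℕ._* a) (C-ratio₂ k (2 ℕ.* m)) ⟩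
  (suc (2 ℕ.* m) ℕ.* suc (suc (2 ℕ.* m))) ℕ.* c ℕ.* a
    ≡⟨ lemma₂ m c a ⟩
  2 ℕ.* (c ℕ.* ((suc m ℕ.* suc (2 ℕ.* m)) ℕ.* a))
    ≤⟨ ℕ.*-monoʳ-≤ 2 (ℕ.*-monoʳ-≤ c growth) ⟩
  2 ℕ.* (c ℕ.* b)
    ≡⟨ cong (λ M → 2 ℕ.* ((M C k) ℕ.* b)) N≡ ⟨
  2 ℕ.* ((N C k) ℕ.* b) ∎)
  where
  open ℕ.≤-Reasoning
  k = 2 ℕ.* suc i
  N = 2 ℕ.* suc (suc i ℕ.+ m)
  c = (k ℕ.+ suc (suc (2 ℕ.* m))) C k
  c″ = (k ℕ.+ suc (suc (2 ℕ.* m))) C suc (suc k)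
  N≡ : N ≡ k ℕ.+ suc (suc (2 ℕ.* m))
  N≡ = lemma i m
    where
    lemma : ∀ i m → 2 ℕ.* suc (suc i ℕ.+ m) ≡ 2 ℕ.* suc i ℕ.+ suc (suc (2 ℕ.* m))
    lemma = ℕ-Solver.solve-∀
  lemma₁ : ∀ c a → 2 ℕ.* (2 ℕ.* (c ℕ.* a)) ≡ 4 ℕ.* (c ℕ.* a)
  lemma₁ = ℕ-Solver.solve-∀
  lemma₂ : ∀ m c a → (suc (2 ℕ.* m) ℕ.* suc (suc (2 ℕ.* m))) ℕ.* c ℕ.* a ≡
           2 ℕ.* (c ℕ.* ((suc m ℕ.* suc (2 ℕ.* m)) ℕ.* a))
  lemma₂ = ℕ-Solver.solve-∀

-- Alternating sums with halving terms, and the signed recurrence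

alternatingSum : ℕ → (ℕ → ℤ) → ℤ
alternatingSum zero    t = 0ℤ
alternatingSum (suc n) t = t 0 - alternatingSum n (t ∘ suc)

alternatingSum-cong : ∀ n {t u} → t ≗ u → alternatingSum n t ≡ alternatingSum n u
alternatingSum-cong zero    t≗u = refl
alternatingSum-cong (suc n) t≗u = cong₂ _-_ (t≗u 0) (alternatingSum-cong n (t≗u ∘ suc))

-- The tail from `t 1` on lies between 0 and `t 1`, hence is at most half of `t 0`. That `s` is a
-- natural number records nonnegativity.
alternatingSum-halving : ∀ n (t : ℕ → ℕ) → (∀ i → i < n → 2 ℕ.* t (suc i) ≤ t i) →
  Σ[ s ∈ ℕ ] alternatingSum (suc n) (+_ ∘ t) ≡ + s × s ≤ t 0 × t 0 ≤ 2 ℕ.* s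
alternatingSum-halving zero    t t↓ = t 0 , ℤ.+-identityʳ _ , ℕ.≤-refl , ℕ.m≤n*m (t 0) 2
alternatingSum-halving (suc n) t t↓ with alternatingSum-halving n (t ∘ suc) (λ i i<n → t↓ (suc i) (s≤s i<n))
... | s , alt≡s , s≤t₁ , _ =
  t 0 ∸ s ,
  trans (cong (λ z → + t 0 - z) alt≡s) (trans (ℤ.m-n≡m⊖n (t 0) s) (ℤ.⊖-≥ s≤t₀)) ,
  ℕ.m∸n≤m (t 0) s ,
  (begin
    t 0                        ≡⟨ ℕ.m+n∸n≡m (t 0) (t 0) ⟨
    t 0 ℕ.+ t 0 ∸ t 0          ≤⟨ ℕ.∸-monoʳ-≤ (t 0 ℕ.+ t 0) 2s≤t₀ ⟩
    t 0 ℕ.+ t 0 ∸ 2 ℕ.* s      ≡⟨ cong (λ z → t 0 ℕ.+ z ∸ 2 ℕ.* s) (ℕ.+-identityʳ (t 0)) ⟨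
    2 ℕ.* t 0 ∸ 2 ℕ.* s        ≡⟨ ℕ.*-distribˡ-∸ 2 (t 0) s ⟨
    2 ℕ.* (t 0 ∸ s)            ∎)
  where
  open ℕ.≤-Reasoning
  2s≤t₀ : 2 ℕ.* s ≤ t 0
  2s≤t₀ = ℕ.≤-trans (ℕ.*-monoʳ-≤ 2 s≤t₁) (t↓ 0 (s≤s z≤n))
  s≤t₀ : s ≤ t 0
  s≤t₀ = ℕ.≤-trans (ℕ.m≤n*m s 2) 2s≤t₀

W : ℕ → ℤ
W n = -1ℤ ^ n * V n

-- The sign splits as (-1)ⁿ = (-1)ⁱ (-1)ⁿ⁻ⁱ: the first factor makes the sum alternate, the second
-- turns `V` into `W`. The bound m ≤ n keeps the subtraction exact.
signed-sum : ∀ m n (c : ℕ → ℤ) → m ≤ n →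
  -1ℤ ^ n * (∑[ i < suc m ] (c (toℕ i) * V (n ∸ toℕ i))) ≡ alternatingSum (suc m) (λ i → c i * W (n ∸ i))
signed-sum zero    n       c _         = lemma (-1ℤ ^ n) (c 0) (V n)
  where
  lemma : ∀ e x y → e * (x * y + 0ℤ) ≡ x * (e * y) - 0ℤ
  lemma = solve-∀
signed-sum (suc m) (suc n) c (s≤s m≤n) = trans
  (lemma (-1ℤ ^ n) (c 0) (V (suc n)) (∑[ i < suc m ] (c (suc (toℕ i)) * V (n ∸ toℕ i))))
  (cong (λ z → c 0 * W (suc n) - z) (signed-sum m n (c ∘ suc) m≤n))
  where
  lemma : ∀ e x y s → (-1ℤ * e) * (x * y + s) ≡ x * (-1ℤ * e * y) - e * s
  lemma = solve-∀

W-rec : ∀ n → W (suc n) ≡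
        + 2 * alternatingSum (suc n) (λ i → + (2 ℕ.* suc n C 2 ℕ.* suc i) * W (n ∸ i))
W-rec n = begin
  -1ℤ * -1ℤ ^ n * V (suc n)                 ≡⟨ cong (-1ℤ * -1ℤ ^ n *_) (V-rec n) ⟩
  -1ℤ * -1ℤ ^ n * (- (+ 2) * s)             ≡⟨ lemma (-1ℤ ^ n) s ⟩
  + 2 * (-1ℤ ^ n * s)                       ≡⟨ cong (+ 2 *_) (signed-sum n n c ℕ.≤-refl) ⟩
  + 2 * alternatingSum (suc n) (λ i → c i * W (n ∸ i)) ∎
  where
  open ≡-Reasoning
  c : ℕ → ℤ
  c i = + (2 ℕ.* suc n C 2 ℕ.* suc i)
  s = ∑[ i < suc n ] (c (toℕ i) * V (n ∸ toℕ i))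
  lemma : ∀ e s → -1ℤ * e * (- (+ 2) * s) ≡ + 2 * (e * s)
  lemma = solve-∀

-- Absolute values give natural numbers before the sign is known; `W-growth` shows that they are the
-- terms of `W` themselves.
w : ℕ → ℕ
w n = ∣ W n ∣

-- Sign and growth are proved together: growth up to n makes the terms of the recurrence for
-- `W (suc n)` at least halve, so their alternating sum is nonnegative and at least half of the
-- first term. Doubled, it is at least C(2n+2, 2) times `w n`.
W-growth : ∀ n → (∀ m → m ≤ n → W m ≡ + w m) ×
                 (∀ m → m < n → (suc m ℕ.* suc (2 ℕ.* m)) ℕ.* w m ≤ w (suc m))
W-growth zero    = (λ { zero _ → refl }) , λ _ ()
W-growth (suc n) with W-growth n
... | W≡w , w-grows with alternatingSum-halving n
        (λ i → (2 ℕ.* suc n C 2 ℕ.* suc i) ℕ.* w (n ∸ i)) t↓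
  where
  t↓ : ∀ i → i < n → 2 ℕ.* ((2 ℕ.* suc n C 2 ℕ.* suc (suc i)) ℕ.* w (n ∸ suc i)) ≤
                     (2 ℕ.* suc n C 2 ℕ.* suc i) ℕ.* w (n ∸ i)
  t↓ i i<n with ℕ.m≤n⇒∃[o]m+o≡n i<n
  ... | m , refl rewrite ℕ.m+n∸m≡n (suc i) m | ℕ.+-∸-assoc 1 (ℕ.m≤m+n i m) | ℕ.m+n∸m≡n i m =
    C-decay i m (w-grows m (s≤s (ℕ.m≤n+m m i)))
... | s , alt≡s , _ , t₀≤2s = W≡w′ , w-grows′
  where
  open ≡-Reasoning
  Wₙ₊₁≡2s : W (suc n) ≡ + (2 ℕ.* s)
  Wₙ₊₁≡2s = begin
    W (suc n)
      ≡⟨ W-rec n ⟩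
    + 2 * alternatingSum (suc n) (λ i → + (2 ℕ.* suc n C 2 ℕ.* suc i) * W (n ∸ i))
      ≡⟨ cong (+ 2 *_) (alternatingSum-cong (suc n) (λ i → trans
           (cong (+ (2 ℕ.* suc n C 2 ℕ.* suc i) *_) (W≡w (n ∸ i) (ℕ.m∸n≤m n i)))
           (sym (ℤ.pos-* (2 ℕ.* suc n C 2 ℕ.* suc i) (w (n ∸ i)))))) ⟩
    + 2 * alternatingSum (suc n) (λ i → + ((2 ℕ.* suc n C 2 ℕ.* suc i) ℕ.* w (n ∸ i)))
      ≡⟨ cong (+ 2 *_) alt≡s ⟩
    + 2 * + s
      ≡⟨ ℤ.pos-* 2 s ⟨
    + (2 ℕ.* s) ∎
  W≡w′ : ∀ m → m ≤ suc n → W m ≡ + w m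
  W≡w′ m m≤1+n with ℕ.m≤n⇒m<n∨m≡n m≤1+n
  ... | inj₁ (s≤s m≤n) = W≡w m m≤n
  ... | inj₂ refl      = trans Wₙ₊₁≡2s (cong (λ z → + ∣ z ∣) (sym Wₙ₊₁≡2s))
  w-grows′ : ∀ m → m < suc n → (suc m ℕ.* suc (2 ℕ.* m)) ℕ.* w m ≤ w (suc m)
  w-grows′ m (s≤s m≤n) with ℕ.m≤n⇒m<n∨m≡n m≤n
  ... | inj₁ m<n  = w-grows m m<n
  ... | inj₂ refl = subst₂ _≤_ (cong (ℕ._* w n) (2nC2 n)) (cong ∣_∣ (sym Wₙ₊₁≡2s)) t₀≤2s

sum-applyUpTo-suc : ∀ (f : ℕ → ℕ) n → sum (applyUpTo f (suc n)) ≡ sum (applyUpTo f n) ℕ.+ f n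
sum-applyUpTo-suc f n = trans (cong sum (sym (applyUpTo-∷ʳ f n)))
  (trans (sum-++ (applyUpTo f n) (f n ∷ [])) (cong (sum (applyUpTo f n) ℕ.+_) (ℕ.+-identityʳ (f n))))

-- Doubling at every step suffices, and the growth factor (n+2)(2n+3) is at least 2.
w-dominates : ∀ n → sum (applyUpTo (w ∘ suc) n) ≤ w (suc n)
w-dominates zero    = z≤n
w-dominates (suc n) = begin
  sum (applyUpTo (w ∘ suc) (suc n))                  ≡⟨ sum-applyUpTo-suc (w ∘ suc) n ⟩
  sum (applyUpTo (w ∘ suc) n) ℕ.+ w (suc n)          ≤⟨ ℕ.+-monoˡ-≤ (w (suc n)) (w-dominates n) ⟩
  w (suc n) ℕ.+ w (suc n)                            ≡⟨ cong (w (suc n) ℕ.+_) (ℕ.+-identityʳ (w (suc n))) ⟨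
  2 ℕ.* w (suc n)                                    ≤⟨ ℕ.*-monoˡ-≤ (w (suc n))
    (ℕ.*-mono-≤ {2} {suc (suc n)} {1} {suc (2 ℕ.* suc n)} (s≤s (s≤s z≤n)) (s≤s z≤n)) ⟩
  (suc (suc n) ℕ.* suc (2 ℕ.* suc n)) ℕ.* w (suc n)  ≤⟨ proj₂ (W-growth (suc (suc n))) (suc n) ℕ.≤-refl ⟩
  w (suc (suc n))                                    ∎
  where open ℕ.≤-Reasoning

-- Cycle decompositions and realizability

⊛-leading : ∀ f g n → (∀ i → i < n → g i ≡ 0ℤ) → (f ⊛ g) n ≡ f 0 * g n
⊛-leading f g zero    _   = refl
⊛-leading f g (suc n) g≡0 = trans
  (cong (_+_ (f 0 * g (suc n))) (trans
    (⊛-leading (f ∘ suc) g n (λ i i<n → g≡0 i (ℕ.m≤n⇒m≤1+n i<n)))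
    (trans (cong (f 1 *_) (g≡0 n ℕ.≤-refl)) (ℤ.*-zeroʳ (f 1)))))
  (ℤ.+-identityʳ _)

-- With nothing below k, the equation for the derivative reads (k + 1) `a (suc k)` = `ρ k`, so the
-- quotient is a coefficient of the integral exponential.
leading-divisible : ∀ (ρ : ℕ → ℕ) k → HasExp (+_ ∘ ρ) → (∀ n → n < k → ρ n ≡ 0) →
                    Σ[ c ∈ ℕ ] c ℕ.* suc k ≡ ρ k
leading-divisible ρ k (a , a₀ , ∂a) ρ≡0 = ∣ a (suc k) ∣ , (begin
  ∣ a (suc k) ∣ ℕ.* suc k      ≡⟨ ℕ.*-comm ∣ a (suc k) ∣ (suc k) ⟩
  suc k ℕ.* ∣ a (suc k) ∣      ≡⟨ ℤ.abs-* (+ suc k) (a (suc k)) ⟨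
  ∣ ∂ a k ∣                    ≡⟨ cong ∣_∣ (∂a k) ⟩
  ∣ (a ⊛ (+_ ∘ ρ)) k ∣         ≡⟨ cong ∣_∣ (⊛-leading a (+_ ∘ ρ) k (λ i i<k → cong +_ (ρ≡0 i i<k))) ⟩
  ∣ a 0 * + ρ k ∣              ≡⟨ cong (λ z → ∣ z * + ρ k ∣) a₀ ⟩
  ∣ 1ℤ * + ρ k ∣               ≡⟨ cong ∣_∣ (ℤ.*-identityˡ (+ ρ k)) ⟩
  ρ k                          ∎)
  where open ≡-Reasoning

hasExp-minus-cycles : ∀ j c {β} → HasExp β → HasExp (λ n → β n - + (c ℕ.* cycleFix j n))
hasExp-minus-cycles j zero    {β} h = hasExp-cong (λ n → sym (ℤ.+-identityʳ (β n))) h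
hasExp-minus-cycles j (suc c) {β} h = hasExp-cong
  (λ n → lemma (β n) (+ (c ℕ.* cycleFix j n)) (+ cycleFix j n))
  (hasExp-+ (hasExp-minus-cycles j c h) (hasExp-neg-cycleFix j))
  where
  lemma : ∀ x y z → (x - y) + - z ≡ x - (z + y)
  lemma = solve-∀

cycleFix-≤ : ∀ j n → cycleFix j n ≤ suc j
cycleFix-≤ j n = by-cases (suc j ∣? suc n)
  where
  by-cases : Dec (suc j ∣ suc n) → cycleFix j n ≤ suc j
  by-cases (yes d) = ℕ.≤-reflexive (cycleFix-∣ d)
  by-cases (no ¬d) = ℕ.≤-trans (ℕ.≤-reflexive (cycleFix-∤ ¬d)) z≤n

sum-applyUpTo-mono : ∀ (f : ℕ → ℕ) {m n} → m ≤ n → sum (applyUpTo f m) ≤ sum (applyUpTo f n)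
sum-applyUpTo-mono f z≤n       = z≤n
sum-applyUpTo-mono f (s≤s m≤n) = ℕ.+-monoʳ-≤ (f 0) (sum-applyUpTo-mono (f ∘ suc) m≤n)

telescope : ∀ m (f g : ℕ → ℕ) → (∀ k → f k ≡ g k ℕ.+ f (suc k)) → f 0 ≡ sum (applyUpTo g m) ℕ.+ f m
telescope zero    f g f≡ = refl
telescope (suc m) f g f≡ = begin
  f 0                                                    ≡⟨ f≡ 0 ⟩
  g 0 ℕ.+ f 1
    ≡⟨ cong (g 0 ℕ.+_) (telescope m (f ∘ suc) (g ∘ suc) (f≡ ∘ suc)) ⟩
  g 0 ℕ.+ (sum (applyUpTo (g ∘ suc) m) ℕ.+ f (suc m))    ≡⟨ ℕ.+-assoc (g 0) _ (f (suc m)) ⟨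
  g 0 ℕ.+ sum (applyUpTo (g ∘ suc) m) ℕ.+ f (suc m)      ∎
  where open ≡-Reasoning

-- ρ is what is left of β once the cycles of length at most k have been accounted for.
record Residue (β : ℕ → ℕ) (k : ℕ) (ρ : ℕ → ℕ) : Set where
  field
    hasExp   : HasExp (+_ ∘ ρ)
    vanishes : ∀ n → n < k → ρ n ≡ 0
    upper    : ∀ n → ρ n ≤ β n
    lower    : ∀ n → β n ≤ ρ n ℕ.+ sum (applyUpTo β k)

-- Index k stands for period k + 1, so removing `ρ k` / (k + 1) cycles of length k + 1 clears it; no
-- later index becomes negative because β dominates its partial sums.
residue-step : ∀ {β k ρ} → (∀ n → sum (applyUpTo β n) ≤ β n) → Residue β k ρ →
  Σ[ c ∈ ℕ ] Σ[ ρ′ ∈ (ℕ → ℕ) ] Residue β (suc k) ρ′ × (∀ n → ρ n ≡ c ℕ.* cycleFix k n ℕ.+ ρ′ n)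
residue-step {β} {k} {ρ} dominates r = c , ρ′ , residue , λ n → sym (ℕ.m+[n∸m]≡n (cycles≤ρ n))
  where
  open Residue r
  c    = proj₁ (leading-divisible ρ k hasExp vanishes)
  c≡   = proj₂ (leading-divisible ρ k hasExp vanishes)
  cycles : ℕ → ℕ
  cycles n = c ℕ.* cycleFix k n
  ρ′ : ℕ → ℕ
  ρ′ n = ρ n ∸ cycles n
  cycles≤ρk : ∀ n → cycles n ≤ ρ k
  cycles≤ρk n = ℕ.≤-trans (ℕ.*-monoʳ-≤ c (cycleFix-≤ k n)) (ℕ.≤-reflexive c≡)
  cycles≤βk : ∀ n → cycles n ≤ β k
  cycles≤βk n = ℕ.≤-trans (cycles≤ρk n) (upper k)
  cycles≤ρ : ∀ n → cycles n ≤ ρ n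
  cycles≤ρ n with ℕ.<-cmp n k
  ... | tri< n<k _ _  = ℕ.≤-trans (ℕ.≤-reflexive (trans (cong (c ℕ.*_) (cycleFix-< n<k)) (ℕ.*-zeroʳ c))) z≤n
  ... | tri≈ _ refl _ = cycles≤ρk n
  -- Earlier steps took at most the sum of β below k away from `β n`, which is at least that sum
  -- plus `β k`; so `β k` is still available.
  ... | tri> _ _ k<n  = ℕ.≤-trans (cycles≤βk n) (ℕ.+-cancelʳ-≤ (sum (applyUpTo β k)) (β k) (ρ n) (begin
    β k ℕ.+ sum (applyUpTo β k)   ≡⟨ ℕ.+-comm (β k) _ ⟩
    sum (applyUpTo β k) ℕ.+ β k   ≡⟨ sum-applyUpTo-suc β k ⟨
    sum (applyUpTo β (suc k))     ≤⟨ sum-applyUpTo-mono β k<n ⟩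
    sum (applyUpTo β n)           ≤⟨ dominates n ⟩
    β n                           ≤⟨ lower n ⟩
    ρ n ℕ.+ sum (applyUpTo β k)   ∎))
    where open ℕ.≤-Reasoning
  residue : Residue β (suc k) ρ′
  residue = record
    { hasExp   = hasExp-cong
        (λ n → trans (ℤ.m-n≡m⊖n (ρ n) (cycles n)) (ℤ.⊖-≥ (cycles≤ρ n)))
        (hasExp-minus-cycles k c hasExp)
    ; vanishes = vanishes′
    ; upper    = λ n → ℕ.≤-trans (ℕ.m∸n≤m (ρ n) (cycles n)) (upper n)
    ; lower    = lower′
    }
    where
    open ℕ.≤-Reasoning
    vanishes′ : ∀ n → n < suc k → ρ′ n ≡ 0
    vanishes′ n (s≤s n≤k) with ℕ.m≤n⇒m<n∨m≡n n≤k
    ... | inj₁ n<k  = trans (cong (_∸ cycles n) (vanishes n n<k)) (ℕ.0∸n≡0 (cycles n))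
    ... | inj₂ refl = trans
      (cong (ρ n ∸_) (trans (cong (c ℕ.*_) (cycleFix-∣ {n} ∣-refl)) c≡)) (ℕ.n∸n≡0 (ρ n))
    lower′ : ∀ n → β n ≤ ρ′ n ℕ.+ sum (applyUpTo β (suc k))
    lower′ n = begin
      β n                                                 ≤⟨ lower n ⟩
      ρ n ℕ.+ sum (applyUpTo β k)                         ≡⟨ cong (ℕ._+ sum (applyUpTo β k)) (ℕ.m∸n+n≡m (cycles≤ρ n)) ⟨
      ρ′ n ℕ.+ cycles n ℕ.+ sum (applyUpTo β k)           ≤⟨ ℕ.+-monoˡ-≤ _ (ℕ.+-monoʳ-≤ (ρ′ n) (cycles≤βk n)) ⟩
      ρ′ n ℕ.+ β k ℕ.+ sum (applyUpTo β k)                ≡⟨ ℕ.+-assoc (ρ′ n) (β k) _ ⟩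
      ρ′ n ℕ.+ (β k ℕ.+ sum (applyUpTo β k))              ≡⟨ cong (ρ′ n ℕ.+_) (ℕ.+-comm (β k) _) ⟩
      ρ′ n ℕ.+ (sum (applyUpTo β k) ℕ.+ β k)              ≡⟨ cong (ρ′ n ℕ.+_) (sum-applyUpTo-suc β k) ⟨
      ρ′ n ℕ.+ sum (applyUpTo β (suc k))                  ∎

-- Index n is settled after n + 1 steps, so the telescoping sum ends there with residue 0.
cycle-decomposition : ∀ β → HasExp (+_ ∘ β) → (∀ n → sum (applyUpTo β n) ≤ β n) →
  Σ[ c ∈ (ℕ → ℕ) ] (∀ n → β n ≡ sum (applyUpTo (λ j → c j ℕ.* cycleFix j n) (suc n)))
cycle-decomposition β h dominates = c , λ n → begin
  β n
    ≡⟨ telescope (suc n) (λ k → ρ k n) (λ k → c k ℕ.* cycleFix k n) (λ k → step k n) ⟩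
  total n ℕ.+ ρ (suc n) n
    ≡⟨ cong (total n ℕ.+_) (Residue.vanishes (proj₂ (state (suc n))) n ℕ.≤-refl) ⟩
  total n ℕ.+ 0
    ≡⟨ ℕ.+-identityʳ (total n) ⟩
  total n ∎
  where
  open ≡-Reasoning
  state : ∀ k → Σ[ ρ ∈ (ℕ → ℕ) ] Residue β k ρ
  state zero    = β , record
    { hasExp = h ; vanishes = λ _ () ; upper = λ _ → ℕ.≤-refl ; lower = λ n → ℕ.m≤m+n (β n) 0 }
  state (suc k) with residue-step dominates (proj₂ (state k))
  ... | _ , ρ′ , r′ , _ = ρ′ , r′
  ρ : ℕ → ℕ → ℕ
  ρ k = proj₁ (state k)
  c : ℕ → ℕ
  c k = proj₁ (residue-step dominates (proj₂ (state k)))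
  step : ∀ k n → ρ k n ≡ c k ℕ.* cycleFix k n ℕ.+ ρ (suc k) n
  step k = proj₂ (proj₂ (proj₂ (residue-step dominates (proj₂ (state k)))))
  total : ℕ → ℕ
  total n = sum (applyUpTo (λ j → c j ℕ.* cycleFix j n) (suc n))

-- Rotations of a finite cycle

rotate : ∀ {j} → Fin (suc j) → Fin (suc j)
rotate {j} i = suc (toℕ i) mod suc j

toℕ-rotate^ : ∀ {j} n (i : Fin (suc j)) → toℕ ((rotate ^^ n) i) ≡ (n ℕ.+ toℕ i) % suc j
toℕ-rotate^ {j} zero    i = sym (m<n⇒m%n≡m (toℕ<n i))
toℕ-rotate^ {j} (suc n) i = begin
  toℕ (rotate ((rotate ^^ n) i))                        ≡⟨ toℕ-fromℕ< _ ⟩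
  suc (toℕ ((rotate ^^ n) i)) % suc j                   ≡⟨ cong (λ z → suc z % suc j) (toℕ-rotate^ n i) ⟩
  (1 ℕ.+ (n ℕ.+ toℕ i) % suc j) % suc j                 ≡⟨ %-distribˡ-+ 1 ((n ℕ.+ toℕ i) % suc j) (suc j) ⟩
  (1 % suc j ℕ.+ (n ℕ.+ toℕ i) % suc j % suc j) % suc j
    ≡⟨ cong (λ z → (1 % suc j ℕ.+ z) % suc j) (m%n%n≡m%n (n ℕ.+ toℕ i) (suc j)) ⟩
  (1 % suc j ℕ.+ (n ℕ.+ toℕ i) % suc j) % suc j         ≡⟨ %-distribˡ-+ 1 (n ℕ.+ toℕ i) (suc j) ⟨
  (suc n ℕ.+ toℕ i) % suc j                             ∎
  where open ≡-Reasoning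

-- A fixed `i` is the remainder of n + i modulo j + 1; cancelling `i` leaves n as a multiple of j +
-- 1.
rotate^-fixed⇒∣ : ∀ {j} n (i : Fin (suc j)) → (rotate ^^ n) i ≡ i → suc j ∣ n
rotate^-fixed⇒∣ {j} n i fixed = divides q (ℕ.+-cancelˡ-≡ (toℕ i) n (q ℕ.* suc j) (begin
  toℕ i ℕ.+ n                            ≡⟨ ℕ.+-comm (toℕ i) n ⟩
  n ℕ.+ toℕ i                            ≡⟨ m≡m%n+[m/n]*n (n ℕ.+ toℕ i) (suc j) ⟩
  (n ℕ.+ toℕ i) % suc j ℕ.+ q ℕ.* suc j  ≡⟨ cong (ℕ._+ q ℕ.* suc j) (toℕ-rotate^ n i) ⟨
  toℕ ((rotate ^^ n) i) ℕ.+ q ℕ.* suc j  ≡⟨ cong (λ z → toℕ z ℕ.+ q ℕ.* suc j) fixed ⟩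
  toℕ i ℕ.+ q ℕ.* suc j                  ∎))
  where
  open ≡-Reasoning
  q = (n ℕ.+ toℕ i) / suc j

∣⇒rotate^-fixed : ∀ {j} n (i : Fin (suc j)) → suc j ∣ n → (rotate ^^ n) i ≡ i
∣⇒rotate^-fixed {j} n i (divides q refl) = toℕ-injective (begin
  toℕ ((rotate ^^ (q ℕ.* suc j)) i)    ≡⟨ toℕ-rotate^ (q ℕ.* suc j) i ⟩
  (q ℕ.* suc j ℕ.+ toℕ i) % suc j      ≡⟨ cong (_% suc j) (ℕ.+-comm (q ℕ.* suc j) (toℕ i)) ⟩
  (toℕ i ℕ.+ q ℕ.* suc j) % suc j      ≡⟨ [m+kn]%n≡m%n (toℕ i) q (suc j) ⟩
  toℕ i % suc j                        ≡⟨ m<n⇒m%n≡m (toℕ<n i) ⟩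
  toℕ i                                ∎)
  where open ≡-Reasoning

-- Counting fixed points in a disjoint union of cycles

Σℕ↔⊎ : ∀ (P : ℕ → Set) → (P 0 ⊎ Σ ℕ (P ∘ suc)) ↔ Σ ℕ P
Σℕ↔⊎ P = mk↔ₛ′
  (λ { (inj₁ p) → 0 , p ; (inj₂ (j , p)) → suc j , p })
  (λ { (zero , p) → inj₁ p ; (suc j , p) → inj₂ (j , p) })
  (λ { (zero , p) → refl ; (suc j , p) → refl })
  (λ { (inj₁ p) → refl ; (inj₂ (j , p)) → refl })

Fin-sum↔Σ : ∀ k (g : ℕ → ℕ) (P : ℕ → Set) → (∀ j → Fin (g j) ↔ P j) → (∀ j → k ≤ j → ¬ P j) →
            Fin (sum (applyUpTo g k)) ↔ Σ ℕ P
Fin-sum↔Σ zero    g P g↔P empty = mk↔ₛ′ (λ ()) (λ (j , p) → ⊥-elim (empty j z≤n p))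
  (λ (j , p) → ⊥-elim (empty j z≤n p)) (λ ())
Fin-sum↔Σ (suc k) g P g↔P empty = ↔-trans +↔⊎ (↔-trans
  (g↔P 0 ⊎-↔ Fin-sum↔Σ k (g ∘ suc) (P ∘ suc) (g↔P ∘ suc) (λ j k≤j → empty (suc j) (s≤s k≤j)))
  (Σℕ↔⊎ P))

-- c j cycles of length j + 1, for every j.
module Cycles (c : ℕ → ℕ) where

  X : Set
  X = Σ[ j ∈ ℕ ] (Fin (c j) × Fin (suc j))

  T : X → X
  T (j , o , i) = j , o , rotate i

  T^ : ∀ n j o i → (T ^^ n) (j , o , i) ≡ (j , o , (rotate ^^ n) i)
  T^ zero    j o i = refl
  T^ (suc n) j o i = cong T (T^ n j o i)

  -- Decidable equality makes equality proofs in `X` unique, so a fixed point is determined by its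
  -- underlying point.
  _≟_ : DecidableEquality X
  _≟_ = ≡-dec ℕ._≟_ (≡-dec Fin._≟_ Fin._≟_)

  fixed⇒∣ : ∀ n j o i → (T ^^ n) (j , o , i) ≡ (j , o , i) → suc j ∣ n
  fixed⇒∣ n j o i fixed = rotate^-fixed⇒∣ n i
    (toℕ-injective (cong (λ (_ , _ , i′) → toℕ i′) (trans (sym (T^ n j o i)) fixed)))

  -- `T` preserves j, so the fixed points split by cycle length; this shape becomes `FixedPoint`
  -- after reassociating Σ.
  FixedOn : ℕ → ℕ → Set
  FixedOn n j = Σ[ p ∈ (Fin (c j) × Fin (suc j)) ] (T ^^ suc n) (j , p) ≡ (j , p)

  Fin↔FixedOn : ∀ n j → Fin (c j ℕ.* cycleFix j n) ↔ FixedOn n j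
  Fin↔FixedOn n j = by-cases (suc j ∣? suc n)
    where
    by-cases : Dec (suc j ∣ suc n) → Fin (c j ℕ.* cycleFix j n) ↔ FixedOn n j
    by-cases (yes d) = subst (λ m → Fin (c j ℕ.* m) ↔ FixedOn n j) (sym (cycleFix-∣ d))
      (↔-trans *↔× (mk↔ₛ′
        (λ (o , i) → (o , i) , trans (T^ (suc n) j o i) (cong (λ i → j , o , i) (∣⇒rotate^-fixed (suc n) i d)))
        proj₁
        (λ (p , eq) → cong (p ,_) (Decidable⇒UIP.≡-irrelevant _≟_ _ eq))
        (λ _ → refl)))
    by-cases (no ¬d) = subst (λ m → Fin m ↔ FixedOn n j)
      (sym (trans (cong (c j ℕ.*_) (cycleFix-∤ ¬d)) (ℕ.*-zeroʳ (c j))))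
      (mk↔ₛ′ (λ ()) (λ ((o , i) , eq) → ⊥-elim (¬d (fixed⇒∣ (suc n) j o i eq)))
        (λ ((o , i) , eq) → ⊥-elim (¬d (fixed⇒∣ (suc n) j o i eq))) (λ ()))

  Fin↔FixedPoint : ∀ n →
    Fin (sum (applyUpTo (λ j → c j ℕ.* cycleFix j n) (suc n))) ↔ FixedPoint (T ^^ suc n)
  Fin↔FixedPoint n = ↔-trans
    (Fin-sum↔Σ (suc n) _ (FixedOn n) (Fin↔FixedOn n)
      -- A cycle longer than n + 1 has no point fixed by `T ^^ suc n`.
      (λ j n<j ((o , i) , eq) → ℕ.<⇒≱ n<j (ℕ.≤-pred (∣⇒≤ (fixed⇒∣ (suc n) j o i eq)))))
    (↔-sym Σ-assoc)

realizable-W : Realizable W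
realizable-W = X , T , count
  where
  W≡w : ∀ n → W n ≡ + w n
  W≡w n = proj₁ (W-growth n) n ℕ.≤-refl
  decomposition = cycle-decomposition (w ∘ suc)
    (hasExp-cong (λ n → W≡w (suc n)) (hasExp-twisted-V -1ℤ)) w-dominates
  open Cycles (proj₁ decomposition)
  count : ∀ n → n ℕ.≥ 1 → ∃[ m ] (W n ≡ + m) × (Fin m ↔ FixedPoint (T ^^ n))
  count (suc n) _ = _ , trans (W≡w (suc n)) (cong +_ (proj₂ decomposition n)) , Fin↔FixedPoint n

theorem5p1 : NewtonEulerSequence (λ n → U (2 ℕ.* n)) × Realizable (λ n → (-1ℤ ^ n) * U (2 ℕ.* n))
theorem5p1 = newtonEuler-V , realizable-W
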